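{- Let $\Gamma\subseteq \mathbf{For}$ be a set of formulas and let $\alpha\in\mathbf{For}$ be a formula. Then $\alpha$ is a relational $HT$-consequence of $\Gamma$ if and only if $\alpha$ is an algebraic consequence of $\Gamma$; that is, $$\Gamma\models_{Rel}\alpha \quad\text{if and only if}\quad \Gamma\models_{Alg}\alpha .$$
   Context: Language. $\mathbf{VarProp}$ is a countable set of propositional variables. $\mathbf{For}$ is the least set containing $\mathbf{VarProp}$ and closed under the binary connectives $\wedge,\vee,\Rightarrow$ and the unary connectives $\neg,S_1,S_2$ (the freely generated set of formulas). HT-algebras. An $HT$-algebra is an algebra $A=(A,0,1,\wedge,\vee,\Rightarrow,\neg,S_1,S_2)$ such that $(A,0,1,\wedge,\vee,\Rightarrow,\neg)$ is a Heyting algebra (with $\neg a=a\Rightarrow 0$), and for all $a,b\in A$ and all $i,j\in\{1,2\}$: $S_i(a\wedge b)=S_ia\wedge S_ib$; $S_i(a\vee b)=S_ia\vee S_ib$; $S_2(a\Rightarrow b)=(S_2a\Rightarrow S_2b)$; $S_1(a\Rightarrow b)=(S_1a\Rightarrow S_1b)\wedge(S_2a\Rightarrow S_2b)$; $S_iS_ja=S_ja$; $S_1a\vee a=a$; $S_1a\vee\neg S_1a=1$. Algebraic semantics. An algebraic model is a pair $(A,h)$ where $A$ is an $HT$-algebra and $h:\mathbf{For}\to A$ is a homomorphism, i.e. $h$ preserves $\wedge,\vee,\Rightarrow,\neg,S_1,S_2$. A formula $\alpha$ is true in $(A,h)$ iff $h(\alpha)=1$. $\Gamma\models_{Alg}\alpha$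 means: for every algebraic model $(A,h)$, if $h(\gamma)=1$ for all $\gamma\in\Gamma$, then $h(\alpha)=1$. Relational semantics. An $HT$-frame is a system $K=(W,R,s_1,s_2)$ where (K0) $W$ is a nonempty set, $R$ is a binary relation on $W$, and $s_1,s_2:W\to W$ are functions, and for all $w,w'\in W$ and $i,j\in\{1,2\}$: (K1) $R$ is reflexive and transitive; (K2) $s_j(s_i(w))=s_j(w)$; (K3) $R(s_1(w),w)$; (K4) $R(w,s_2(w))$; (K5) $R(w,w')$ implies $R(s_i(w),s_i(w'))$ and $R(s_i(w'),s_i(w))$; (K6) for every $w\in W$ there are $i\in\{1,2\}$ and $w'\in W$ with $w=s_i(w')$. An $HT$-model based on $K$ is $M=(K,m)$ where $m:\mathbf{VarProp}\to\mathcal P(W)$ satisfies: $R(w,w')$ and $w\in m(p)$ imply $w'\in m(p)$. Satisfaction $M,w\ sat\ \alpha$ is defined recursively: $M,w\ sat\ p$ iff $w\in m(p)$; $M,w\ sat\ \alpha\wedge\beta$ iff $M,w\ sat\ \alpha$ and $M,w\ sat\ \beta$; $M,w\ sat\ \alpha\vee\beta$ iff $M,w\ sat\ \alpha$ or $M,w\ sat\ \beta$; $M,w\ sat\ \alpha\Rightarrow\beta$ iff for all $w'$, if $R(w,w')$ and $M,w'\ sat\ \alpha$ then $M,w'\ sat\ \beta$; $M,w\ sat\ \neg\alpha$ iff for all $w'$ with $R(w,w')$, not $M,w'\ sat\ \alpha$; $M,w\ sat\ S_i\alpha$ iff $M,s_i(w)\ sat\ \alpha$. A formula $\alpha$ is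 true in $M$ iff $M,w\ sat\ \alpha$ for every $w\in W$. $\Gamma\models_{Rel}\alpha$ means: for every $HT$-model $M$ (based on any $HT$-frame), if all formulas of $\Gamma$ are true in $M$ then $\alpha$ is true in $M$. -}

module Defs where

open import Level using (Level; _⊔_; suc)
open import Data.Product using (_×_; ∃-syntax)
open import Data.Sum using (_⊎_)
open import Relation.Nullary using (¬_)
open import Relation.Unary using (Pred; _∈_)
open import Relation.Binary.Core using (Rel)
open import Relation.Binary.Definitions using (Reflexive; Transitive)
open import Relation.Binary.PropositionalEquality using (_≡_)
open import Relation.Binary.Lattice using (HeytingAlgebra)
import Relation.Binary.Lattice.Properties.HeytingAlgebra as HeytingProperties

data Index : Set where
  one two : Index

-- Equality is the setoid equality of the underlying Heyting algebra, so
-- each S i must be required to respect it.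
record HTAlgebra (c ℓ₁ ℓ₂ : Level) : Set (suc (c ⊔ ℓ₁ ⊔ ℓ₂)) where
  field
    heytingAlgebra : HeytingAlgebra c ℓ₁ ℓ₂

  open HeytingAlgebra heytingAlgebra public
  -- neg a = a ⇨ ⊥
  open HeytingProperties heytingAlgebra public using () renaming (¬_ to neg)

  field
    S      : Index → Carrier → Carrier
    S-cong : ∀ i {a b} → a ≈ b → S i a ≈ S i b
    S-∧    : ∀ i a b → S i (a ∧ b) ≈ (S i a ∧ S i b)
    S-∨    : ∀ i a b → S i (a ∨ b) ≈ (S i a ∨ S i b)
    S₂-⇨   : ∀ a b → S two (a ⇨ b) ≈ (S two a ⇨ S two b)
    S₁-⇨   : ∀ a b → S one (a ⇨ b) ≈ ((S one a ⇨ S one b) ∧ (S two a ⇨ S two b))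
    S-S    : ∀ i j a → S i (S j a) ≈ S j a
    S₁-∨   : ∀ a → (S one a ∨ a) ≈ a
    S₁-lem : ∀ a → (S one a ∨ neg (S one a)) ≈ ⊤

infixr 5 _⇒_
infixr 6 _∨_
infixr 7 _∧_
infix  8 ~_

data For {v} (V : Set v) : Set v where
  var         : V → For V
  _∧_ _∨_ _⇒_ : For V → For V → For V
  ~_          : For V → For V
  S           : Index → For V → For V

record AlgModel {v} (V : Set v) (c ℓ₁ ℓ₂ : Level) : Set (v ⊔ suc (c ⊔ ℓ₁ ⊔ ℓ₂)) where
  field
    algebra : HTAlgebra c ℓ₁ ℓ₂

  private module A = HTAlgebra algebra

  field
    h   : For V → A.Carrier
    h-∧ : ∀ α β → h (α ∧ β) A.≈ (h α A.∧ h β)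
    h-∨ : ∀ α β → h (α ∨ β) A.≈ (h α A.∨ h β)
    h-⇒ : ∀ α β → h (α ⇒ β) A.≈ (h α A.⇨ h β)
    h-~ : ∀ α → h (~ α) A.≈ A.neg (h α)
    h-S : ∀ i α → h (S i α) A.≈ A.S i (h α)

  TrueAlg : For V → Set ℓ₁
  TrueAlg α = h α A.≈ A.⊤

record HTFrame (w r : Level) : Set (suc (w ⊔ r)) where
  field
    W        : Set w
    R        : Rel W r
    s        : Index → W → W
    nonempty : W
    R-refl   : Reflexive R
    R-trans  : Transitive R
    s-s      : ∀ i j w → s j (s i w) ≡ s j w
    s₁-R     : ∀ w → R (s one w) w
    R-s₂     : ∀ w → R w (s two w)
    R-s      : ∀ i w w′ → R w w′ → R (s i w) (s i w′) × R (s i w′) (s i w)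
    s-onto   : ∀ w → ∃[ i ] ∃[ w′ ] w ≡ s i w′

record HTModel {v} (V : Set v) (ℓ : Level) : Set (v ⊔ suc ℓ) where
  field
    frame : HTFrame ℓ ℓ

  open HTFrame frame public

  field
    val      : V → Pred W ℓ
    val-mono : ∀ p {w w′} → R w w′ → w ∈ val p → w′ ∈ val p

  sat : W → For V → Set ℓ
  sat w (var p) = w ∈ val p
  sat w (α ∧ β) = sat w α × sat w β
  sat w (α ∨ β) = sat w α ⊎ sat w β
  sat w (α ⇒ β) = ∀ w′ → R w w′ → sat w′ α → sat w′ β
  sat w (~ α)   = ∀ w′ → R w w′ → ¬ sat w′ α
  sat w (S i α) = sat (s i w) α

  TrueRel : For V → Set ℓ
  TrueRel α = ∀ w → sat w α

-- Both consequence relations range over the models in one universe Set ℓ, the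
-- one in which the variables and membership in Γ live; ℓ is arbitrary.
module _ {ℓ : Level} {V : Set ℓ} where

  infix 4 _⊨Alg_ _⊨Rel_

  _⊨Alg_ : Pred (For V) ℓ → For V → Set (suc ℓ)
  Γ ⊨Alg α = (M : AlgModel V ℓ ℓ ℓ) → let open AlgModel M in
             (∀ γ → γ ∈ Γ → TrueAlg γ) → TrueAlg α

  _⊨Rel_ : Pred (For V) ℓ → For V → Set (suc ℓ)
  Γ ⊨Rel α = (M : HTModel V ℓ) → let open HTModel M in
             (∀ γ → γ ∈ Γ → TrueRel γ) → TrueRel α

{-# OPTIONS --safe #-}

-- Completeness needs only two-point frames.  In an HT-algebra the elements
-- S i a are complemented, and S j (S i a) = S i a, so on the subalgebra generated
-- by a valuation S₁ and S₂ are determined by the complemented elements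
-- S i (h p), p a variable.  If h α ≠ 1 then ¬ S₁ (h α) ≠ 0; as there are countably
-- many variables, this element can be refined to a decreasing sequence of
-- nonzero elements deciding every S i (h p).  Letting p hold at the point i iff
-- the sequence goes below S i (h p) gives a model on one < two with s i w = i,
-- in which β holds at i iff the sequence goes below S i (h β).
-- For soundness, an HT-model is turned into an algebra on the formulas
-- themselves, ordered by inclusion of truth sets.
module Submission where

open import Defs
open import Level using (Level; Lift; lift)
open import Data.Empty using () renaming (⊥-elim to absurd)
open import Data.Nat using (ℕ; zero; suc; _+_)
open import Data.Nat.Properties using (+-comm)
open import Data.Product using (_×_; _,_; proj₁; proj₂; ∃-syntax; swap; <_,_>)
open import Data.Product.Function.NonDependent.Propositional using (_×-⇔_)
open import Data.Sum as Sum using (_⊎_; inj₁; inj₂; [_,_]′)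
open import Data.Sum.Function.Propositional using (_⊎-⇔_)
open import Function using (_∘_; id)
open import Function.Bundles using (_↣_; _⇔_; mk⇔; Equivalence; Injection)
open import Function.Construct.Composition using (_⇔-∘_)
open import Function.Construct.Symmetry using (⇔-sym)
open import Relation.Nullary using (¬_; Dec; yes; no)
open import Relation.Unary using (Pred)
open import Relation.Binary.Core using (Rel)
open import Relation.Binary.Definitions using (Reflexive; Transitive)
open import Relation.Binary.Lattice using (HeytingAlgebra)
open import Relation.Binary.PropositionalEquality using (_≡_; refl; sym; subst)
import Relation.Binary.Lattice.Properties.HeytingAlgebra as HeytingProperties
open import Axiom.ExcludedMiddle using (ExcludedMiddle)

-- Persistence of truth and the points above `s i w` in an HT-model.

module Persistence {v ℓ} {V : Set v} (M : HTModel V ℓ) where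
  open HTModel M

  persistent : ∀ β {w w′} → R w w′ → sat w β → sat w′ β
  persistent (var p) r = val-mono p r
  persistent (β ∧ γ) r (b , c) = persistent β r b , persistent γ r c
  persistent (β ∨ γ) r = Sum.map (persistent β r) (persistent γ r)
  persistent (β ⇒ γ) r f w″ r′ = f w″ (R-trans r r′)
  persistent (~ β)   r f w″ r′ = f w″ (R-trans r r′)
  persistent (S i β) r = persistent β (proj₁ (R-s i _ _ r))

  -- By (K6), w′ = s i w″, so that s i w′ = w′; applying s i to the relation
  -- R (s j w) w′ turns it by (K5) into an equivalence of s i w and w′.
  above-s : ∀ j {w w′} → R (s j w) w′ → ∃[ i ] R (s i w) w′ × R w′ (s i w)
  above-s j {w} {w′} r with s-onto w′
  ... | i , w″ , refl with R-s i _ _ r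
  ... | a , b rewrite s-s j i w | s-s i i w″ = i , a , b

  -- By `above-s` every point above `s j w` is equivalent to `s one w` or `s two w`, and truth is
  -- invariant under equivalence, so testing those two points suffices.
  above-s-⇒ : ∀ j {w w′} β γ → R (s j w) w′ →
              (∀ i → sat (s i w) β → sat (s i w) γ) → sat w′ β → sat w′ γ
  above-s-⇒ j β γ r f b with above-s j r
  ... | i , to , from = persistent γ to (f i (persistent β from b))

  -- (K4) leads from `w′` to `s two w′`, and (K5) with (K2) from there back to `s two w`. So
  -- `s two w` is maximal up to equivalence, and an implication there concerns that point alone.
  above-s₂ : ∀ {w w′} → R (s two w) w′ → R w′ (s two w)
  above-s₂ {w} {w′} r = R-trans (R-s₂ w′)
    (subst (R (s two w′)) (s-s two two w) (proj₂ (R-s two _ _ r)))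

-- The HT-algebra of formulas of an HT-model.

module Lindenbaum {ℓ} {V : Set ℓ} (em : ExcludedMiddle ℓ) (M : HTModel V ℓ) (α : For V) where
  open HTModel M
  open Persistence M

  _≤_ _≈_ : Rel (For V) ℓ
  β ≤ γ = ∀ w → sat w β → sat w γ
  β ≈ γ = β ≤ γ × γ ≤ β

  -- For V has no constants, and is empty when V is: hence the parameter α.
  ⊤ ⊥ : For V
  ⊤ = α ⇒ α
  ⊥ = α ∧ ~ α

  ⊥-unsat : ∀ w → ¬ sat w ⊥
  ⊥-unsat w (a , ¬a) = ¬a w R-refl a

  heytingAlgebra : HeytingAlgebra ℓ ℓ ℓ
  heytingAlgebra = record
    { Carrier = For V
    ; _≈_ = _≈_
    ; _≤_ = _≤_
    ; _∨_ = _∨_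
    ; _∧_ = _∧_
    ; _⇨_ = _⇒_
    ; ⊤   = ⊤
    ; ⊥   = ⊥
    ; isHeytingAlgebra = record
      { isBoundedLattice = record
        { isLattice = record
          { isPartialOrder = record
            { isPreorder = record
              { isEquivalence = record
                { refl  = (λ _ → id) , (λ _ → id)
                ; sym   = swap
                ; trans = λ (p , p′) (q , q′) → (λ w → q w ∘ p w) , (λ w → p′ w ∘ q′ w)
                }
              ; reflexive = proj₁
              ; trans     = λ p q w → q w ∘ p w
              }
            ; antisym = _,_
            }
          ; supremum = λ _ _ → (λ _ → inj₁) , (λ _ → inj₂) , (λ _ p q w → [ p w , q w ]′)
          ; infimum  = λ _ _ → (λ _ → proj₁) , (λ _ → proj₂) , (λ _ p q w → < p w , q w >)
          }
        ; maximum = λ _ _ _ _ _ → id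
        ; minimum = λ _ w → absurd ∘ ⊥-unsat w
        }
      ; exponential = λ β _ _ →
          (λ f w b w′ r c → f w′ (persistent β r b , c)) ,
          (λ f w (b , c) → f w b w R-refl c)
      }
    }

  S₂-⇒ : ∀ β γ → S two (β ⇒ γ) ≈ (S two β ⇒ S two γ)
  S₂-⇒ β γ =
    (λ w f w′ r → f (s two w′) (proj₁ (R-s two _ _ r))) ,
    (λ w f w′ r b → persistent γ r (f w R-refl (persistent β (above-s₂ r) b)))

  S₁-⇒ : ∀ β γ → S one (β ⇒ γ) ≈ ((S one β ⇒ S one γ) ∧ (S two β ⇒ S two γ))
  S₁-⇒ β γ =
    (λ w f →
      (λ w′ r → f (s one w′) (proj₁ (R-s one _ _ r))) ,
      (λ w′ r → f (s two w′)
        -- The path runs from `s one w` through `s one w′` and `w′` to `s two w′`.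
        (R-trans (proj₁ (R-s one _ _ r)) (R-trans (s₁-R w′) (R-s₂ w′))))) ,
    (λ w (f , g) w′ r → above-s-⇒ one β γ r
      λ { one → f w R-refl ; two → g w R-refl })

  -- For `w′` above `w`, (K5) makes `s one w` and `s one w′` equivalent; hence if `β` fails at the
  -- former, it fails at every latter.
  S₁-lem : ∀ β → (S one β ∨ (S one β ⇒ ⊥)) ≈ ⊤
  S₁-lem β = (λ _ _ _ _ → id) , λ w _ → decide w em
    where
    decide : ∀ w → Dec (sat (s one w) β) → sat w (S one β ∨ (S one β ⇒ ⊥))
    decide w (yes b) = inj₁ b
    decide w (no ¬b) = inj₂ λ w′ r b →
      absurd (¬b (persistent β (proj₂ (R-s one _ _ r)) b))

  algebra : HTAlgebra ℓ ℓ ℓ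
  algebra = record
    { heytingAlgebra = heytingAlgebra
    ; S      = S
    ; S-cong = λ i (p , q) → (λ w → p (s i w)) , (λ w → q (s i w))
    ; S-∧    = λ _ _ _ → (λ _ → id) , (λ _ → id)
    ; S-∨    = λ _ _ _ → (λ _ → id) , (λ _ → id)
    ; S₂-⇨   = S₂-⇒
    ; S₁-⇨   = S₁-⇒
    ; S-S    = λ i j β → (λ w → subst (λ u → sat u β) (s-s i j w)) ,
                         (λ w → subst (λ u → sat u β) (sym (s-s i j w)))
    ; S₁-∨   = λ β → (λ w → [ persistent β (s₁-R w) , id ]′) , (λ _ → inj₂)
    ; S₁-lem = S₁-lem
    }

  model : AlgModel V ℓ ℓ ℓ
  model = record
    { algebra = algebra
    ; h   = id
    ; h-∧ = λ _ _ → (λ _ → id) , (λ _ → id)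
    ; h-∨ = λ _ _ → (λ _ → id) , (λ _ → id)
    ; h-⇒ = λ _ _ → (λ _ → id) , (λ _ → id)
    ; h-~ = λ _ → (λ _ f w′ r b → absurd (f w′ r b)) ,
                  (λ _ f w′ r b → ⊥-unsat w′ (f w′ r b))
    ; h-S = λ _ _ → (λ _ → id) , (λ _ → id)
    }

  TrueAlg⇔TrueRel : ∀ β → AlgModel.TrueAlg model β ⇔ TrueRel β
  TrueAlg⇔TrueRel β = mk⇔ (λ (_ , q) w → q w (λ _ _ → id))
                          (λ t → (λ _ _ _ _ → id) , (λ w _ → t w))

-- Order properties of the operators of an HT-algebra.

module HTProperties {c ℓ₁ ℓ₂} (A : HTAlgebra c ℓ₁ ℓ₂) where
  open HTAlgebra A renaming (_∧_ to _⊓_; _∨_ to _⊔_; S to □; refl to ≤-refl)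

  □-mono : ∀ i {x y} → x ≤ y → □ i x ≤ □ i y
  □-mono i {x} {y} x≤y = trans
    (reflexive (Eq.trans (S-cong i (antisym (∧-greatest ≤-refl x≤y) (x∧y≤x x y))) (S-∧ i x y)))
    (x∧y≤y _ _)

  □₁-decreasing : ∀ x → □ one x ≤ x
  □₁-decreasing x = trans (x≤x∨y _ _) (reflexive (S₁-∨ x))

  □₁≤□ : ∀ i x → □ one x ≤ □ i x
  □₁≤□ one x = ≤-refl
  □₁≤□ two x = trans (reflexive (Eq.sym (S-S two one x))) (□-mono two (□₁-decreasing x))

  -- `□ i` fixes `□ one ⊥`, which lies above `⊥` trivially and below it because `□ one` is
  -- decreasing.
  □-⊥ : ∀ i → □ i ⊥ ≤ ⊥
  □-⊥ i = trans (□-mono i (minimum _)) (trans (reflexive (S-S i one ⊥)) (□₁-decreasing ⊥))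

  -- In `S₁-⇨` at `⊥ ⇨ ⊥`, both factors on the right are implications from an element to itself.
  □-⊤ : ∀ i → ⊤ ≤ □ i ⊤
  □-⊤ i = trans (∧-greatest (transpose-⇨ (x∧y≤y _ _)) (transpose-⇨ (x∧y≤y _ _)))
    (trans (reflexive (Eq.sym (S₁-⇨ ⊥ ⊥)))
    (trans (□-mono one (maximum _)) (□₁≤□ i ⊤)))

  -- If the negation were zero, `S₁-lem` would make `□ one x` the top, and with it the larger `x`.
  neg-□₁-nonzero : ∀ {x} → ¬ (x ≈ ⊤) → ¬ (neg (□ one x) ≤ ⊥)
  neg-□₁-nonzero {x} x≉⊤ ¬□≤⊥ = x≉⊤ (antisym (maximum x)
    (trans (reflexive (Eq.sym (S₁-lem x)))
           (∨-least (□₁-decreasing x) (trans ¬□≤⊥ (minimum x)))))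

-- The filter generated by a decreasing sequence of nonzero elements.

module Chain {c ℓ₁ ℓ₂} (H : HeytingAlgebra c ℓ₁ ℓ₂) (g : ℕ → HeytingAlgebra.Carrier H)
  (g-anti : ∀ n → HeytingAlgebra._≤_ H (g (suc n)) (g n))
  (g-nonzero : ∀ n → ¬ HeytingAlgebra._≤_ H (g n) (HeytingAlgebra.⊥ H)) where

  open HeytingAlgebra H renaming (_∧_ to _⊓_; _∨_ to _⊔_; refl to ≤-refl)
  open HeytingProperties H using (⇨-eval; ⇨-applyˡ; y≤x⇨y; ∧-distribˡ-∨-≤)
    renaming (¬_ to neg)

  -- `Forced` is membership in that filter, which is proper but need not be prime; on the elements
  -- it decides it behaves like an ultrafilter.
  Forced Decides : Carrier → Set ℓ₂
  Forced x  = ∃[ n ] g n ≤ x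
  Decides x = Forced x ⊎ Forced (neg x)

  g-anti-+ : ∀ m n → g (m + n) ≤ g n
  g-anti-+ zero    n = ≤-refl
  g-anti-+ (suc m) n = trans (g-anti (m + n)) (g-anti-+ m n)

  Forced-mono : ∀ {x y} → x ≤ y → Forced x → Forced y
  Forced-mono x≤y (n , gn≤x) = n , trans gn≤x x≤y

  Forced-resp : ∀ {x y} → x ≈ y → Forced x ⇔ Forced y
  Forced-resp x≈y = mk⇔ (Forced-mono (reflexive x≈y)) (Forced-mono (reflexive (Eq.sym x≈y)))

  Forced-meet : ∀ {x y} → Forced x → Forced y → Forced (x ⊓ y)
  Forced-meet (m , p) (n , q) = m + n , ∧-greatest
    (trans (subst (λ k → g k ≤ g m) (+-comm n m) (g-anti-+ n m)) p) (trans (g-anti-+ m n) q)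

  ¬Forced-⊥ : ∀ {x} → x ≤ ⊥ → ¬ Forced x
  ¬Forced-⊥ x≤⊥ (n , gn≤x) = g-nonzero n (trans gn≤x x≤⊥)

  Forced-modus-ponens : ∀ {x y} → Forced (x ⇨ y) → Forced x → Forced y
  Forced-modus-ponens f p = Forced-mono ⇨-eval (Forced-meet f p)

  Forced-∧ : ∀ {x y} → Forced (x ⊓ y) ⇔ (Forced x × Forced y)
  Forced-∧ = mk⇔ < Forced-mono (x∧y≤x _ _) , Forced-mono (x∧y≤y _ _) >
                 (λ (p , q) → Forced-meet p q)

  -- Deciding one disjunct is enough, because `neg x ⊓ (x ⊔ y) ≤ y`.
  Forced-∨ : ∀ {x y} → Decides x → Forced (x ⊔ y) ⇔ (Forced x ⊎ Forced y)
  Forced-∨ {x} {y} d = mk⇔ (to d) [ Forced-mono (x≤x∨y _ _) , Forced-mono (y≤x∨y _ _) ]′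
    where
    to : Decides x → Forced (x ⊔ y) → Forced x ⊎ Forced y
    to (inj₁ p) _ = inj₁ p
    to (inj₂ q) f = inj₂ (Forced-mono
      (trans (∧-distribˡ-∨-≤ _ _ _) (∨-least (trans ⇨-eval (minimum y)) (x∧y≤y _ _)))
      (Forced-meet q f))

  Forced-⇨ : ∀ {x y} → Decides x → Forced (x ⇨ y) ⇔ (Forced x → Forced y)
  Forced-⇨ {x} {y} d = mk⇔ Forced-modus-ponens (from d)
    where
    from : Decides x → (Forced x → Forced y) → Forced (x ⇨ y)
    from (inj₁ p) f = Forced-mono y≤x⇨y (f p)
    from (inj₂ q) f = Forced-mono (transpose-⇨ (trans ⇨-eval (minimum y))) q

  Decides-resp : ∀ {x y} → y ≈ x → Decides x → Decides y
  Decides-resp y≈x = Sum.map (Forced-mono (reflexive (Eq.sym y≈x)))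
                             (Forced-mono (transpose-⇨ (⇨-applyˡ (reflexive y≈x))))

  Decides-∧ : ∀ {x y} → Decides x → Decides y → Decides (x ⊓ y)
  Decides-∧ (inj₁ p) (inj₁ q) = inj₁ (Forced-meet p q)
  Decides-∧ (inj₂ p) _        = inj₂ (Forced-mono (transpose-⇨ (⇨-applyˡ (x∧y≤x _ _))) p)
  Decides-∧ _        (inj₂ q) = inj₂ (Forced-mono (transpose-⇨ (⇨-applyˡ (x∧y≤y _ _))) q)

  Decides-∨ : ∀ {x y} → Decides x → Decides y → Decides (x ⊔ y)
  Decides-∨ (inj₁ p) _        = inj₁ (Forced-mono (x≤x∨y _ _) p)
  Decides-∨ _        (inj₁ q) = inj₁ (Forced-mono (y≤x∨y _ _) q)
  Decides-∨ (inj₂ p) (inj₂ q) = inj₂ (Forced-mono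
    (transpose-⇨ (trans (∧-distribˡ-∨-≤ _ _ _)
      (∨-least (transpose-∧ (x∧y≤x _ _)) (transpose-∧ (x∧y≤y _ _)))))
    (Forced-meet p q))

  Decides-⇨ : ∀ {x y} → Decides x → Decides y → Decides (x ⇨ y)
  Decides-⇨ (inj₂ p) _        = inj₁ (Forced-mono (transpose-⇨ (trans ⇨-eval (minimum _))) p)
  Decides-⇨ _        (inj₁ q) = inj₁ (Forced-mono y≤x⇨y q)
  -- This case rests on `x ⊓ neg y ≤ neg (x ⇨ y)`.
  Decides-⇨ (inj₁ p) (inj₂ q) = inj₂ (Forced-mono
    (transpose-⇨ (trans
      (∧-greatest (trans (x∧y≤x _ _) (x∧y≤y _ _))
        (trans (∧-greatest (x∧y≤y _ _) (trans (x∧y≤x _ _) (x∧y≤x _ _))) ⇨-eval))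
      ⇨-eval))
    (Forced-meet p q))

-- Shrinking a nonzero element so that it decides a given one.

module Refinement {c ℓ₁ ℓ₂} (H : HeytingAlgebra c ℓ₁ ℓ₂) (em : ExcludedMiddle ℓ₂) where
  open HeytingAlgebra H renaming (_∧_ to _⊓_; refl to ≤-refl)
  open HeytingProperties H using () renaming (¬_ to neg)

  -- The meet with `x` is avoided only when it is zero, and then `g` already lies below `neg x`.
  refine : Carrier → Carrier → Carrier
  refine x g with em {g ⊓ x ≤ ⊥}
  ... | yes _ = g
  ... | no _  = g ⊓ x

  refine-≤ : ∀ x g → refine x g ≤ g
  refine-≤ x g with em {g ⊓ x ≤ ⊥}
  ... | yes _ = ≤-refl
  ... | no _  = x∧y≤x g x

  refine-nonzero : ∀ x {g} → ¬ (g ≤ ⊥) → ¬ (refine x g ≤ ⊥)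
  refine-nonzero x {g} g≰⊥ with em {g ⊓ x ≤ ⊥}
  ... | yes _ = g≰⊥
  ... | no ≰⊥ = ≰⊥

  refine-decides : ∀ x g → refine x g ≤ x ⊎ refine x g ≤ neg x
  refine-decides x g with em {g ⊓ x ≤ ⊥}
  ... | yes ≤⊥ = inj₂ (transpose-⇨ ≤⊥)
  ... | no _   = inj₁ (x∧y≤y g x)

-- The frame on two comparable points.

module TwoPointFrame {ℓ : Level} where

  data _≼_ : Rel (Lift ℓ Index) ℓ where
    ≼-refl  : Reflexive _≼_
    one≼two : lift one ≼ lift two

  ≼-trans : Transitive _≼_
  ≼-trans ≼-refl  r      = r
  ≼-trans one≼two ≼-refl = one≼two

  frame : HTFrame ℓ ℓ
  frame = record
    { W        = Lift ℓ Index
    ; R        = _≼_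
    ; s        = λ i _ → lift i
    ; nonempty = lift one
    ; R-refl   = ≼-refl
    ; R-trans  = ≼-trans
    ; s-s      = λ _ _ _ → refl
    ; s₁-R     = λ { (lift one) → ≼-refl ; (lift two) → one≼two }
    ; R-s₂     = λ { (lift one) → one≼two ; (lift two) → ≼-refl }
    ; R-s      = λ _ _ _ _ → ≼-refl , ≼-refl
    ; s-onto   = λ (lift i) → i , lift i , refl
    }

-- The model read off the sequence, and its truth lemma.

module Countermodel {ℓ} {V : Set ℓ} (em : ExcludedMiddle ℓ) (V↣ℕ : V ↣ ℕ)
  (M : AlgModel V ℓ ℓ ℓ) (g₀ : HTAlgebra.Carrier (AlgModel.algebra M))
  (g₀-nonzero : ¬ HTAlgebra._≤_ (AlgModel.algebra M) g₀ (HTAlgebra.⊥ (AlgModel.algebra M)))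
  where

  open AlgModel M
  open HTAlgebra algebra
    renaming (_∧_ to _⊓_; _∨_ to _⊔_; S to □; S-∧ to □-∧; S-∨ to □-∨; refl to ≤-refl)
  open HTProperties algebra
  open Refinement heytingAlgebra em
  open Injection V↣ℕ using (to; injective)
  open TwoPointFrame {ℓ}

  -- Stage `n` treats the variable with code `n`, if there is one. The decision is an explicit
  -- argument so that the facts about stages follow by cases on it.
  stage : ∀ {n} → Dec (∃[ p ] to p ≡ n) → Carrier → Carrier
  stage (yes (p , _)) = refine (□ two (h (var p))) ∘ refine (□ one (h (var p)))
  stage (no _)        = id

  stage-≤ : ∀ {n} (d : Dec (∃[ p ] to p ≡ n)) g → stage d g ≤ g
  stage-≤ (yes _) g = trans (refine-≤ _ _) (refine-≤ _ _)
  stage-≤ (no _)  g = ≤-refl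

  stage-nonzero : ∀ {n} (d : Dec (∃[ p ] to p ≡ n)) {g} → ¬ (g ≤ ⊥) → ¬ (stage d g ≤ ⊥)
  stage-nonzero (yes _) = refine-nonzero _ ∘ refine-nonzero _
  stage-nonzero (no _)  = id

  stage-decides : ∀ p (d : Dec (∃[ q ] to q ≡ to p)) g i →
    let x = □ i (h (var p)) in stage d g ≤ x ⊎ stage d g ≤ neg x
  stage-decides p (no ∄q)        g i = absurd (∄q (p , refl))
  stage-decides p (yes (q , eq)) g i with injective eq
  stage-decides p (yes (q , eq)) g one | refl =
    -- The inner refinement settles the index `one`; the outer one only descends further.
    Sum.map (trans (refine-≤ _ _)) (trans (refine-≤ _ _)) (refine-decides _ g)
  stage-decides p (yes (q , eq)) g two | refl = refine-decides _ _

  g : ℕ → Carrier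
  g zero    = g₀
  g (suc n) = stage {n} em (g n)

  g-nonzero : ∀ n → ¬ (g n ≤ ⊥)
  g-nonzero zero    = g₀-nonzero
  g-nonzero (suc n) = stage-nonzero {n} em (g-nonzero n)

  g-anti : ∀ n → g (suc n) ≤ g n
  g-anti n = stage-≤ {n} em (g n)

  open Chain heytingAlgebra g g-anti g-nonzero

  -- Stage `to p` produces the element of index `suc (to p)`, the first known to decide the literals
  -- of `p`.
  literal-decided : ∀ p i → Decides (□ i (h (var p)))
  literal-decided p i = Sum.map (suc (to p) ,_) (suc (to p) ,_) (stage-decides p em _ i)

  □⇨-decided : ∀ {x y} → (∀ i → Decides (□ i x)) → (∀ i → Decides (□ i y)) →
               ∀ i → Decides (□ i (x ⇨ y))
  □⇨-decided dx dy one = Decides-resp (S₁-⇨ _ _)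
    (Decides-∧ (Decides-⇨ (dx one) (dy one)) (Decides-⇨ (dx two) (dy two)))
  □⇨-decided dx dy two = Decides-resp (S₂-⇨ _ _) (Decides-⇨ (dx two) (dy two))

  □⊥-decided : ∀ i → Decides (□ i ⊥)
  □⊥-decided i = inj₂ (0 , transpose-⇨ (trans (x∧y≤y _ _) (□-⊥ i)))

  decided : ∀ β i → Decides (□ i (h β))
  decided (var p) i = literal-decided p i
  decided (β ∧ γ) i = Decides-resp (Eq.trans (S-cong i (h-∧ β γ)) (□-∧ i _ _))
                                   (Decides-∧ (decided β i) (decided γ i))
  decided (β ∨ γ) i = Decides-resp (Eq.trans (S-cong i (h-∨ β γ)) (□-∨ i _ _))
                                   (Decides-∨ (decided β i) (decided γ i))
  decided (β ⇒ γ) i = Decides-resp (S-cong i (h-⇒ β γ)) (□⇨-decided (decided β) (decided γ) i)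
  decided (~ β)   i = Decides-resp (S-cong i (h-~ β)) (□⇨-decided (decided β) □⊥-decided i)
  -- The inner operator absorbs the outer one, so `i` drops out.
  decided (S j β) i = Decides-resp (Eq.trans (S-cong i (h-S j β)) (S-S i j _)) (decided β j)

  model : HTModel V ℓ
  model = record
    { frame    = frame
    ; val      = λ p (lift i) → Forced (□ i (h (var p)))
    ; val-mono = λ { p ≼-refl → id ; p one≼two → Forced-mono (□₁≤□ two _) }
    }

  open HTModel model using (sat)

  -- The point `one` sees both points, which matches the two factors of `S₁-⇨`; the point `two` sees
  -- only itself, which matches `S₂-⇨`. Arbitrary `P` and `Q` let this serve negation too, with `Q`
  -- empty and `y` the bottom.
  above-⇔-Forced-⇨ : ∀ {a b} {P : Pred (Lift ℓ Index) a} {Q : Pred (Lift ℓ Index) b} {x y} →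
    (∀ i → Decides (□ i x)) →
    (∀ i → P (lift i) ⇔ Forced (□ i x)) → (∀ i → Q (lift i) ⇔ Forced (□ i y)) →
    ∀ i → (∀ w → lift i ≼ w → P w → Q w) ⇔ Forced (□ i (x ⇨ y))
  above-⇔-Forced-⇨ {P = P} {Q} {x} {y} d P⇔ Q⇔ = λ where
      one → ⇔-sym (Forced-resp (S₁-⇨ x y)) ⇔-∘ (⇔-sym Forced-∧ ⇔-∘
              ((pointwise one ×-⇔ pointwise two) ⇔-∘ above-one))
      two → ⇔-sym (Forced-resp (S₂-⇨ x y)) ⇔-∘ (pointwise two ⇔-∘ above-two)
    where
    open Equivalence renaming (to to ⇔-to; from to ⇔-from)

    At : Index → Set _
    At i = P (lift i) → Q (lift i)

    above-one : (∀ w → lift one ≼ w → P w → Q w) ⇔ (At one × At two)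
    above-one = mk⇔ (λ f → f _ ≼-refl , f _ one≼two)
                    (λ (f , f′) → λ { _ ≼-refl → f ; _ one≼two → f′ })

    above-two : (∀ w → lift two ≼ w → P w → Q w) ⇔ At two
    above-two = mk⇔ (λ f → f _ ≼-refl) (λ f → λ { _ ≼-refl → f })

    pointwise : ∀ i → At i ⇔ Forced (□ i x ⇨ □ i y)
    pointwise i = ⇔-sym (Forced-⇨ (d i)) ⇔-∘
      mk⇔ (λ f → ⇔-to (Q⇔ i) ∘ f ∘ ⇔-from (P⇔ i)) (λ f → ⇔-from (Q⇔ i) ∘ f ∘ ⇔-to (P⇔ i))

  -- Induction on the formula: each axiom moves `□ i` inside a connective, and `decided` supplies
  -- the classical behaviour needed for disjunction, implication and negation.
  sat⇔Forced : ∀ β i → sat (lift i) β ⇔ Forced (□ i (h β))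
  sat⇔Forced (var p) i = mk⇔ id id
  sat⇔Forced (β ∧ γ) i = ⇔-sym (Forced-resp (Eq.trans (S-cong i (h-∧ β γ)) (□-∧ i _ _))) ⇔-∘
    (⇔-sym Forced-∧ ⇔-∘ (sat⇔Forced β i ×-⇔ sat⇔Forced γ i))
  sat⇔Forced (β ∨ γ) i = ⇔-sym (Forced-resp (Eq.trans (S-cong i (h-∨ β γ)) (□-∨ i _ _))) ⇔-∘
    (⇔-sym (Forced-∨ (decided β i)) ⇔-∘ (sat⇔Forced β i ⊎-⇔ sat⇔Forced γ i))
  sat⇔Forced (β ⇒ γ) i = ⇔-sym (Forced-resp (S-cong i (h-⇒ β γ))) ⇔-∘
    above-⇔-Forced-⇨ (decided β) (sat⇔Forced β) (sat⇔Forced γ) i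
  sat⇔Forced (~ β)   i = ⇔-sym (Forced-resp (S-cong i (h-~ β))) ⇔-∘
    above-⇔-Forced-⇨ (decided β) (sat⇔Forced β)
      (λ j → mk⇔ absurd (¬Forced-⊥ (□-⊥ j))) i
  sat⇔Forced (S j β) i = ⇔-sym (Forced-resp (Eq.trans (S-cong i (h-S j β)) (S-S i j _))) ⇔-∘
    sat⇔Forced β j

  TrueAlg⇒TrueRel : ∀ β → TrueAlg β → HTModel.TrueRel model β
  TrueAlg⇒TrueRel β t (lift i) = Equivalence.from (sat⇔Forced β i)
    (0 , trans (maximum _) (trans (□-⊤ i) (□-mono i (reflexive (Eq.sym t)))))

-- The two directions of the equivalence.

Alg⇒Rel : ∀ {ℓ} {V : Set ℓ} → ExcludedMiddle ℓ → (Γ : Pred (For V) ℓ) (α : For V) →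
          Γ ⊨Alg α → Γ ⊨Rel α
Alg⇒Rel em Γ α Γ⊨α M Γ-true = to (TrueAlg⇔TrueRel α)
  (Γ⊨α model (λ γ γ∈Γ → from (TrueAlg⇔TrueRel γ) (Γ-true γ γ∈Γ)))
  where
  open Lindenbaum em M α
  open Equivalence

Rel⇒Alg : ∀ {ℓ} {V : Set ℓ} → ExcludedMiddle ℓ → V ↣ ℕ → (Γ : Pred (For V) ℓ) (α : For V) →
          Γ ⊨Rel α → Γ ⊨Alg α
Rel⇒Alg em V↣ℕ Γ α Γ⊨α M Γ-true with em {AlgModel.TrueAlg M α}
... | yes α-true = α-true
-- The sequence starts at `neg (□ one (h α))`, while truth of `α` at the point `one` forces
-- `□ one (h α)`; the meet of the two is zero.
... | no ¬α-true = absurd (¬Forced-⊥ ⇨-eval (Forced-meet (0 , ≤-refl) α-forced))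
  where
  open AlgModel M
  open HTAlgebra algebra using (heytingAlgebra; neg) renaming (S to □; refl to ≤-refl)
  open HeytingProperties heytingAlgebra using (⇨-eval)
  open Countermodel em V↣ℕ M (neg (□ one (h α)))
    (HTProperties.neg-□₁-nonzero algebra ¬α-true)
  open Chain heytingAlgebra g g-anti g-nonzero using (Forced; Forced-meet; ¬Forced-⊥)

  α-forced : Forced (□ one (h α))
  α-forced = Equivalence.to (sat⇔Forced α one)
    (Γ⊨α model (λ γ γ∈Γ → TrueAlg⇒TrueRel γ (Γ-true γ γ∈Γ)) (lift one))

theorem5p5 : {ℓ : Level} → ExcludedMiddle ℓ →
    (VarProp : Set ℓ) → VarProp ↣ ℕ →
    (Γ : Pred (For VarProp) ℓ) (α : For VarProp) →
    (Γ ⊨Rel α) ⇔ (Γ ⊨Alg α)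
theorem5p5 em _ V↣ℕ Γ α = mk⇔ (Rel⇒Alg em V↣ℕ Γ α) (Alg⇒Rel em Γ α)
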